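{- Let $k\ge 2$ be an integer and let $D$ be a digraph on $n$ vertices with dichromatic number $\vec\chi(D)\le k$ or chromatic number $\chi(D)\le 2k$. Then: \begin{itemize} \item[I.] If $D$ is sink-free, then $D$ has a quasi-kernel of size at most $\left(1-\frac1k\right)n$. \item[II.] $D$ has a quasi-kernel of size at most $n-\frac{s}{k}$, where $s$ is the number of sources of $D$ that are not sinks of $D$. \item[III.] $D$ has a quasi-kernel $Q$ such that $|N^-[Q]|\ge \frac{n}{k}$. \end{itemize}
   Context: Digraphs $D=(V(D),A(D))$ are finite, without loops or parallel arcs; a pair of opposite arcs $uv,vu$ (directed 2-cycle) is allowed. If $xy\in A(D)$, then $y$ is an out-neighbor of $x$ and $x$ is an in-neighbor of $y$. A sink is a vertex with no out-neighbors; a source is a vertex with no in-neighbors; a digraph is sink-free if it has no sinks. For vertices $u,v$, $\mathrm{dist}(u,v)\in\mathbb{Z}^{\ge 0}\cup\{\infty\}$ is the length of a shortest directed path from $u$ to $v$, and for $S\subseteq V(D)$, $\mathrm{dist}(u,S)=\min_{v\in S}\mathrm{dist}(u,v)$ (equal to $\infty$ if $S=\emptyset$). Define $N^-[S]=\{u\in V(D):\mathrm{dist}(u,S)\le 1\}$. A set of vertices is independent if there is no arc between any two of its vertices, and acyclic if the subdigraph it induces contains no directed cycle (directed 2-cycles count as directed cycles). A quasi-kernel of $D$ is an independent set $Q\subseteq V(D)$ such that $\mathrm{dist}(u,Q)\le 2$ for every $u\in V(D)$. The chromatic number $\chi(D)$ is the smallest $m$ such that $V(D)$ can be partitioned into $m$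 independent sets. The dichromatic number $\vec\chi(D)$ is the smallest $m$ such that $V(D)$ can be partitioned into $m$ acyclic sets. -}

module Defs where

open import Data.Fin using (Fin; zero; suc; inject₁; fromℕ; finToFun; funToFin)
open import Data.Fin.Properties using (any?; all?; injective⇒≤; finToFun-funToFin) renaming (_≟_ to _≟ᶠ_)
open import Data.Fin.Subset using (Subset; _∈_; Nonempty)
open import Data.Fin.Subset.Properties using (_∈?_; nonempty?)
open import Data.List using (map; filter; allFin)
import Data.List.Extrema as Extrema
open import Data.Nat using (ℕ; zero; suc; _≤_; _<_; _≤?_; s≤s; z≤n; NonZero; >-nonZero)
open import Data.Nat.Properties using (≤-isTotalOrder; ≤-trans; ≮⇒≥; anyUpTo?; m<1+n⇒m<n∨m≡n)
open import Data.Product using (∃; _×_; _,_; proj₁; proj₂)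
open import Data.Sum using (_⊎_; inj₁; inj₂)
open import Data.Vec using (tabulate)
open import Data.Vec.Properties using (tabulate-cong; lookup∘tabulate; lookup⇒[]=; []=⇒lookup)
open import Function using (_∘_; Injective)
open import Level using (0ℓ)
open import Relation.Binary using (Rel; TotalOrder)
import Relation.Binary.Definitions as B
import Relation.Binary.Construct.Add.Supremum.NonStrict as Supremum
open import Relation.Binary.PropositionalEquality using (_≡_; _≗_; refl; sym; trans; cong; subst; subst₂)
open import Relation.Nullary using (Dec; does; yes; no; ¬_; ¬?; map′; _×-dec_; _→-dec_; contradiction)
open import Relation.Nullary.Decidable using (dec-true)
open import Relation.Nullary.Construct.Add.Supremum using (_⁺; [_]; ⊤⁺)
open import Relation.Unary using (Pred; Decidable)

-- Loops are excluded by arc-irrefl; parallel arcs cannot be expressed, as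
-- Arc is only ever used as a relation.
record Digraph (n : ℕ) : Set₁ where
  field
    Arc        : Rel (Fin n) 0ℓ
    arc?       : B.Decidable Arc
    arc-irrefl : ∀ {v} → ¬ Arc v v

open Digraph public

-- [ d ] is the natural number d, and ⊤⁺ is ∞.
ℕ∞ : Set
ℕ∞ = ℕ ⁺

open Supremum _≤_ public using () renaming (_≤⁺_ to _≤∞_)

_≤∞?_ : B.Decidable _≤∞_
_≤∞?_ = Supremum.≤⁺-dec _≤_ _≤?_

≤∞-totalOrder : TotalOrder 0ℓ 0ℓ 0ℓ
≤∞-totalOrder = record { isTotalOrder = Supremum.≤⁺-isTotalOrder-≡ _≤_ ≤-isTotalOrder }

------------------------------------------------------------------------
-- Least natural numbers with a decidable property

IsLeast : Pred ℕ 0ℓ → Pred ℕ 0ℓ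
IsLeast P m = P m × (∀ j → P j → m ≤ j)

data IsMin (P : Pred ℕ 0ℓ) : ℕ∞ → Set where
  finite   : ∀ {m} → IsLeast P m → IsMin P [ m ]
  infinite : (∀ m → ¬ P m) → IsMin P ⊤⁺

searchBelow : {P : Pred ℕ 0ℓ} → Decidable P → ∀ b →
              ∃ (IsLeast P) ⊎ (∀ {j} → j < b → ¬ P j)
searchBelow P? zero = inj₂ (λ ())
searchBelow {P} P? (suc b) with searchBelow P? b
... | inj₁ found = inj₁ found
... | inj₂ none with P? b
...   | yes Pb = inj₁ (b , Pb , λ j Pj → ≮⇒≥ (λ j<b → none j<b Pj))
...   | no ¬Pb = inj₂ (λ j<1+b Pj → absurd (m<1+n⇒m<n∨m≡n j<1+b) Pj)
  where
  absurd : ∀ {j} → j < b ⊎ j ≡ b → ¬ P j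
  absurd (inj₁ j<b)  = none j<b
  absurd (inj₂ refl) = ¬Pb

least : {P : Pred ℕ 0ℓ} → Decidable P → ∃ P → ∃ (IsLeast P)
least P? (m , Pm) with searchBelow P? m
... | inj₁ found = found
... | inj₂ none  = m , Pm , λ j Pj → ≮⇒≥ (λ j<m → none j<m Pj)

minimum : {P : Pred ℕ 0ℓ} → Decidable P → ∀ b → (∀ {j} → P j → j < b) → ∃ (IsMin P)
minimum P? b bounded with searchBelow P? b
... | inj₁ (m , min) = [ m ] , finite min
... | inj₂ none      = ⊤⁺ , infinite (λ m Pm → none (bounded Pm) Pm)

-- Exhaustive search over all functions Fin m → Fin n.
anyFunction? : ∀ {m n} {P : Pred (Fin m → Fin n) 0ℓ} →
               (∀ {f g} → f ≗ g → P f → P g) → Decidable P → Dec (∃ P)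
anyFunction? resp P? =
  map′ (λ (i , p) → finToFun i , p)
       (λ (f , p) → funToFin f , resp (sym ∘ finToFun-funToFin f) p)
       (any? (P? ∘ finToFun))

module _ {n : ℕ} (D : Digraph n) where

  ----------------------------------------------------------------------
  -- Paths and distance

  -- The vertices are p 0, …, p ℓ; distinctness makes this a path, of length ℓ.
  IsDirectedPath : ∀ {ℓ} → Pred (Fin (suc ℓ) → Fin n) 0ℓ
  IsDirectedPath {ℓ} p =
    Injective _≡_ _≡_ p × (∀ (i : Fin ℓ) → Arc D (p (inject₁ i)) (p (suc i)))

  PathOfLength : Fin n → Fin n → Pred ℕ 0ℓ
  PathOfLength u v ℓ =
    ∃ λ (p : Fin (suc ℓ) → Fin n) → IsDirectedPath p × p zero ≡ u × p (fromℕ ℓ) ≡ v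

  isDirectedPath? : ∀ {ℓ} → Decidable (IsDirectedPath {ℓ})
  isDirectedPath? p =
    map′ (λ inj {i} {j} → inj i j) (λ inj i j → inj)
         (all? λ i → all? λ j → (p i ≟ᶠ p j) →-dec (i ≟ᶠ j))
    ×-dec all? (λ i → arc? D (p (inject₁ i)) (p (suc i)))

  isDirectedPath-resp : ∀ {ℓ} {p q : Fin (suc ℓ) → Fin n} →
                        p ≗ q → IsDirectedPath p → IsDirectedPath q
  isDirectedPath-resp p≗q (inj , arcs) =
    (λ {i} {j} eq → inj (trans (p≗q i) (trans eq (sym (p≗q j))))) ,
    (λ i → subst₂ (Arc D) (p≗q _) (p≗q _) (arcs i))

  pathOfLength? : ∀ u v → Decidable (PathOfLength u v)
  pathOfLength? u v ℓ = anyFunction?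
    (λ p≗q (path , start , end) →
      isDirectedPath-resp p≗q path , trans (sym (p≗q _)) start , trans (sym (p≗q _)) end)
    (λ p → isDirectedPath? p ×-dec (p zero ≟ᶠ u) ×-dec (p (fromℕ ℓ) ≟ᶠ v))

  pathLength<n : ∀ {u v ℓ} → PathOfLength u v ℓ → ℓ < n
  pathLength<n (_ , (inj , _) , _) = injective⇒≤ inj

  distance : ∀ u v → ∃ (IsMin (PathOfLength u v))
  distance u v = minimum (pathOfLength? u v) n pathLength<n

  dist : Fin n → Fin n → ℕ∞
  dist u v = proj₁ (distance u v)

  distTo : Fin n → Subset n → ℕ∞
  distTo u S = Extrema.min ≤∞-totalOrder ⊤⁺ (map (dist u) (filter (_∈? S) (allFin n)))

  -- N⁻[S]
  closedN⁻ : Subset n → Subset n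
  closedN⁻ S = tabulate (λ u → does (distTo u S ≤∞? [ 1 ]))

  ----------------------------------------------------------------------
  -- Sinks, sources, quasi-kernels

  Sink : Pred (Fin n) 0ℓ
  Sink v = ∀ w → ¬ Arc D v w

  Source : Pred (Fin n) 0ℓ
  Source v = ∀ u → ¬ Arc D u v

  SinkFree : Set
  SinkFree = ∀ v → ¬ Sink v

  sink? : Decidable Sink
  sink? v = all? (λ w → ¬? (arc? D v w))

  source? : Decidable Source
  source? v = all? (λ u → ¬? (arc? D u v))

  nonSinkSources : Subset n
  nonSinkSources = tabulate (λ v → does (source? v ×-dec ¬? (sink? v)))

  Independent : Pred (Subset n) 0ℓ
  Independent S = ∀ u v → u ∈ S → v ∈ S → ¬ Arc D u v

  QuasiKernel : Pred (Subset n) 0ℓ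
  QuasiKernel Q = Independent Q × (∀ u → distTo u Q ≤∞ [ 2 ])

  ----------------------------------------------------------------------
  -- Acyclic sets

  -- A directed path closed up by an arc from its last vertex to its first;
  -- its length is suc ℓ, and ℓ = 0 is impossible since there are no loops.
  IsDirectedCycle : ∀ {ℓ} → Pred (Fin (suc ℓ) → Fin n) 0ℓ
  IsDirectedCycle {ℓ} c = IsDirectedPath c × Arc D (c (fromℕ ℓ)) (c zero)

  -- The directed cycles of the subdigraph induced by S are the directed
  -- cycles of D all of whose vertices lie in S.
  CycleIn : Subset n → Pred ℕ 0ℓ
  CycleIn S ℓ = ∃ λ (c : Fin (suc ℓ) → Fin n) → IsDirectedCycle c × (∀ i → c i ∈ S)

  Acyclic : Pred (Subset n) 0ℓ
  Acyclic S = ∀ ℓ → ¬ CycleIn S ℓ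

  independent? : Decidable Independent
  independent? S =
    all? λ u → all? λ v → (u ∈? S) →-dec ((v ∈? S) →-dec ¬? (arc? D u v))

  cycleIn? : ∀ S → Decidable (CycleIn S)
  cycleIn? S ℓ = anyFunction?
    (λ c≗d ((path , close) , c⊆S) →
      (isDirectedPath-resp c≗d path , subst₂ (Arc D) (c≗d _) (c≗d _) close) ,
      (λ i → subst (_∈ S) (c≗d i) (c⊆S i)))
    (λ c → (isDirectedPath? c ×-dec arc? D (c (fromℕ ℓ)) (c zero)) ×-dec all? (λ i → c i ∈? S))

  cycleIn-bound : ∀ {S ℓ} → CycleIn S ℓ → ℓ < n
  cycleIn-bound (_ , ((inj , _) , _) , _) = injective⇒≤ inj

  acyclic? : Decidable Acyclic
  acyclic? S =
    map′ (λ none ℓ cyc → none (ℓ , cycleIn-bound cyc , cyc))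
         (λ acyc (ℓ , _ , cyc) → acyc ℓ cyc)
         (¬? (anyUpTo? (cycleIn? S) n))

------------------------------------------------------------------------
-- Partitions

class : ∀ {n m} → (Fin n → Fin m) → Fin m → Subset n
class f i = tabulate (λ v → does (f v ≟ᶠ i))

-- A partition of the n vertices into m (nonempty) parts, given by the map
-- sending each vertex to the index of its part.
IsPartitionInto : ∀ {n m} → Pred (Subset n) 0ℓ → Pred (Fin n → Fin m) 0ℓ
IsPartitionInto P f = ∀ i → Nonempty (class f i) × P (class f i)

PartitionableInto : ∀ {n} → Pred (Subset n) 0ℓ → Pred ℕ 0ℓ
PartitionableInto {n} P m = ∃ λ (f : Fin n → Fin m) → IsPartitionInto P f

∈class⇒≡ : ∀ {n m} (f : Fin n → Fin m) {v i} → v ∈ class f i → f v ≡ i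
∈class⇒≡ f {v} {i} v∈ with f v ≟ᶠ i | trans (sym (lookup∘tabulate _ v)) ([]=⇒lookup v∈)
... | yes eq | _ = eq

≡⇒∈class : ∀ {n m} (f : Fin n → Fin m) {v i} → f v ≡ i → v ∈ class f i
≡⇒∈class f {v} {i} eq =
  lookup⇒[]= v _ (trans (lookup∘tabulate _ v) (dec-true (f v ≟ᶠ i) eq))

class-cong : ∀ {n m} {f g : Fin n → Fin m} → f ≗ g → class f ≗ class g
class-cong f≗g i = tabulate-cong (λ v → cong (λ j → does (j ≟ᶠ i)) (f≗g v))

partitionableInto? : ∀ {n} {P : Pred (Subset n) 0ℓ} → Decidable P → Decidable (PartitionableInto P)
partitionableInto? {P = P} P? m = anyFunction?
  (λ f≗g part i → subst (λ S → Nonempty S × P S) (class-cong f≗g i) (part i))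
  (λ f → all? (λ i → nonempty? (class f i) ×-dec P? (class f i)))

module _ {n : ℕ} (D : Digraph n) where

  singletonsIndependent : PartitionableInto (Independent D) n
  singletonsIndependent = (λ v → v) , λ i →
    (i , ≡⇒∈class (λ v → v) refl) ,
    λ u v u∈ v∈ uv → arc-irrefl D
      (subst₂ (Arc D) (∈class⇒≡ (λ v → v) u∈) (∈class⇒≡ (λ v → v) v∈) uv)

  independent⇒acyclic : ∀ {S} → Independent D S → Acyclic D S
  independent⇒acyclic ind ℓ (c , (_ , close) , c⊆S) = ind _ _ (c⊆S (fromℕ ℓ)) (c⊆S zero) close

  singletonsAcyclic : PartitionableInto (Acyclic D) n
  singletonsAcyclic with singletonsIndependent
  ... | f , part = f , λ i → proj₁ (part i) , independent⇒acyclic (proj₂ (part i))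

  leastIndependentPartition : ∃ (IsLeast (PartitionableInto (Independent D)))
  leastIndependentPartition =
    least (partitionableInto? (independent? D)) (n , singletonsIndependent)

  leastAcyclicPartition : ∃ (IsLeast (PartitionableInto (Acyclic D)))
  leastAcyclicPartition =
    least (partitionableInto? (acyclic? D)) (n , singletonsAcyclic)

  chromaticNumber : ℕ
  chromaticNumber = proj₁ leastIndependentPartition

  dichromaticNumber : ℕ
  dichromaticNumber = proj₁ leastAcyclicPartition

≥2⇒nonZero : ∀ {k} → 2 ≤ k → NonZero k
≥2⇒nonZero 2≤k = >-nonZero (≤-trans (s≤s z≤n) 2≤k)

module Submission where

-- Call a set of vertices kernel-perfect if each of its subsets B has a
-- kernel, an independent subset K of B with B ⊆ N⁻[ K ]. Acyclic sets are
-- kernel-perfect, because their nonempty subsets have sinks; so is a union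
-- of two independent sets, because a subset of it without sinks has either
-- side as a kernel (acyclic⇒kernelPerfect, bipartite⇒kernelPerfect). Under
-- either hypothesis, the vertices can thus be coloured with k colours so
-- that all classes are kernel-perfect.
--
-- The key fact is quasiKernelAbsorbing: for A kernel-perfect, some
-- quasi-kernel Q has A ⊆ N⁻[ Q ]. Indeed, take a quasi-kernel R of the part
-- outside N⁻[ A ], and add a kernel of A ─ N⁻ R. There are no arcs between
-- the two, all of A is within distance 1, and hence N⁻ A is within
-- distance 2. Singletons A provide the induction that constructs R. For A a
-- largest class, this gives the bound on N⁻[ Q ].
--
-- For the sources, let S be the set of sources that are not sinks. Some class
-- contains out-neighbours, necessarily outside S, of at least ∣ S ∣ / k
-- elements of S. Take a quasi-kernel of the complement of S such that all
-- vertices of this class outside S are within distance 1 of it. Then these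
-- ∣ S ∣ / k sources are within distance 2, and it suffices to add the elements
-- of S that are farther away.
--
-- Let D be sink-free. Take a quasi-kernel Q with class 0 inside N⁻[ Q ], put
-- N = N⁻ Q, choose Q₀ ⊆ Q with N ⊆ N⁻ Q₀ and ∣ Q₀ ∣ ≤ ∣ N ∣, let P be the set
-- of vertices of Q ─ Q₀ without out-neighbours in N, and M the set of vertices
-- outside Q₀, N and P. Then Q₀ ∪ P is a quasi-kernel. The out-neighbours of P
-- lie in M and outside class 0, so there is a class A among the other k - 1
-- such that the set S of vertices of P with an out-neighbour in M ∩ A
-- satisfies ∣ P ∣ ≤ (k - 1) ∣ S ∣. Take a quasi-kernel R of M with M ∩ A inside
-- N⁻[ R ]. It is reached from S in two steps, and there are no arcs from M to
-- Q₀ ∪ P, so R ∪ ((Q₀ ∪ (P ─ S)) ─ N⁻ R) is a quasi-kernel too.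
--
-- If ∣ S ∣ ≤ ∣ M ∣, then ∣ Q₀ ∣ + ∣ P ∣ is at most k - 1 times ∣ N ∣ + ∣ M ∣, so
-- the first quasi-kernel has at most (1 - 1/k) n elements. If ∣ M ∣ ≤ ∣ S ∣,
-- then ∣ M ∣ + ∣ Q₀ ∣ + ∣ P ─ S ∣ is at most k - 1 times ∣ N ∣ + ∣ S ∣, and the
-- second one does. That k - 1 is positive is used in ∣ Q₀ ∣ ≤ (k - 1) ∣ N ∣.

open import Defs
open import Data.Fin using (Fin; zero; suc; toℕ; fromℕ; fromℕ<; inject₁; inject≤; combine; remQuot)
open import Data.Fin.Properties
  using (any?; pigeonhole; toℕ<n; toℕ-inject₁; toℕ-fromℕ; toℕ-fromℕ<;
         toℕ-injective; inject≤-injective; combine-remQuot)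
  renaming (_≟_ to _≟ᶠ_)
open import Data.Fin.Subset using (∣_∣)
open import Data.Fin.Subset
  using (Subset; inside; outside; _∈_; _∉_; _⊆_; _⊂_; _∪_; _∩_; _─_; ∁; ⊤; ⊥; ⁅_⁆; Nonempty)
open import Data.Fin.Subset.Induction using (Acc; acc; ⊂-wellFounded)
open import Data.Fin.Subset.Properties
  using (_∈?_; nonempty?; p⊆q⇒∣p∣≤∣q∣; ∣p∣≤n; ∣⊤∣≡n; ∣⊥∣≡0; ∣⁅x⁆∣≡1; ∈⊤; ⊆⊤; ∉⊥; Empty-unique;
         x∈⁅x⁆; x∈⁅y⁆⇒x≡y; x∈∁p⇒x∉p; x∉p⇒x∈∁p; x∉∁p⇒x∈p; p∩q⊆p; p∩q⊆q; x∈p∩q⁺; x∈p∩q⁻;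
         p⊆p∪q; q⊆p∪q; x∈p∪q⁻; p─q⊆p; x∈p∧x∉q⇒x∈p─q; ⊆-refl; ⊆-trans)
open import Data.Integer using (+_)
open import Data.Integer using (1ℤ)
import Data.Integer as ℤ
import Data.Integer.Properties as ℤP
import Data.Integer.Tactic.RingSolver as ℤR
open import Data.List using () renaming ([] to []ᴸ; _∷_ to _∷ᴸ_)
import Data.List.Extrema as Extrema
open import Data.List.Membership.Propositional using (lose)
open import Data.List.Membership.Propositional.Properties using (∈-map⁺; ∈-filter⁺; ∈-allFin)
open import Data.Nat using (ℕ; _≤_; _*_)
open import Data.Nat using (NonZero; zero; suc; _+_; _∸_; _<_; _≤?_; z≤n; s≤s)
open import Data.Nat.Properties
import Data.Nat.Tactic.RingSolver as ℕR
open import Data.Product using (_×_; ∃-syntax)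
open import Data.Product using (∃; _,_; proj₁; proj₂)
open import Data.Rational.Unnormalised as ℚ using (1ℚᵘ; _/_)
open import Data.Sum using (_⊎_)
open import Data.Sum using (inj₁; inj₂; [_,_]′)
open import Data.Vec using ([]; _∷_; here; there; tabulate)
open import Data.Vec.Properties using (lookup∘tabulate; lookup⇒[]=; []=⇒lookup)
open import Function using (_∘_; Injective)
open import Level using (0ℓ)
open import Relation.Binary.Definitions using (tri<; tri≈; tri>)
open import Relation.Binary.PropositionalEquality
  using (_≡_; _≢_; refl; sym; trans; cong; cong₂; subst; subst₂)
open import Relation.Nullary using (¬_; ¬?; yes; no; does; contradiction; _×-dec_)
open import Relation.Nullary.Decidable using (dec-true; decidable-stable; toSum)
open import Relation.Nullary.Construct.Add.Supremum using ([_])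
open import Relation.Binary.Construct.Add.Supremum.NonStrict _≤_ using (≤⁺-trans) renaming ([_] to finite≤)
open import Relation.Unary using (Pred; Decidable)

------------------------------------------------------------------------
-- Finite sets and their cardinalities

-- The subset of the elements with a decidable property.
select : ∀ {n} {P : Pred (Fin n) 0ℓ} → Decidable P → Subset n
select P? = tabulate (does ∘ P?)

∈-select⁺ : ∀ {n} {P : Pred (Fin n) 0ℓ} (P? : Decidable P) {v} → P v → v ∈ select P?
∈-select⁺ P? {v} Pv = lookup⇒[]= v _ (trans (lookup∘tabulate _ v) (dec-true (P? v) Pv))

∈-select⁻ : ∀ {n} {P : Pred (Fin n) 0ℓ} (P? : Decidable P) {v} → v ∈ select P? → P v
∈-select⁻ P? {v} v∈ with P? v | trans (sym (lookup∘tabulate _ v)) ([]=⇒lookup v∈)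
... | yes Pv | _ = Pv

x∈p─q⇒x∉q : ∀ {n} (p q : Subset n) {x} → x ∈ p ─ q → x ∉ q
x∈p─q⇒x∉q (_ ∷ p) (outside ∷ q) (there x∈) (there x∈q) = x∈p─q⇒x∉q p q x∈ x∈q
x∈p─q⇒x∉q (_ ∷ p) (inside  ∷ q) (there x∈) (there x∈q) = x∈p─q⇒x∉q p q x∈ x∈q

∣p∪q∣+∣p∩q∣≡∣p∣+∣q∣ : ∀ {n} (p q : Subset n) → ∣ p ∪ q ∣ + ∣ p ∩ q ∣ ≡ ∣ p ∣ + ∣ q ∣
∣p∪q∣+∣p∩q∣≡∣p∣+∣q∣ []            []            = refl
∣p∪q∣+∣p∩q∣≡∣p∣+∣q∣ (outside ∷ p) (outside ∷ q) = ∣p∪q∣+∣p∩q∣≡∣p∣+∣q∣ p q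
∣p∪q∣+∣p∩q∣≡∣p∣+∣q∣ (inside  ∷ p) (outside ∷ q) = cong suc (∣p∪q∣+∣p∩q∣≡∣p∣+∣q∣ p q)
∣p∪q∣+∣p∩q∣≡∣p∣+∣q∣ (outside ∷ p) (inside  ∷ q) =
  trans (cong suc (∣p∪q∣+∣p∩q∣≡∣p∣+∣q∣ p q)) (sym (+-suc ∣ p ∣ ∣ q ∣))
∣p∪q∣+∣p∩q∣≡∣p∣+∣q∣ (inside  ∷ p) (inside  ∷ q) =
  cong suc (trans (+-suc ∣ p ∪ q ∣ ∣ p ∩ q ∣)
           (trans (cong suc (∣p∪q∣+∣p∩q∣≡∣p∣+∣q∣ p q)) (sym (+-suc ∣ p ∣ ∣ q ∣))))

∣p∪q∣≤∣p∣+∣q∣ : ∀ {n} (p q : Subset n) → ∣ p ∪ q ∣ ≤ ∣ p ∣ + ∣ q ∣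
∣p∪q∣≤∣p∣+∣q∣ p q = subst (∣ p ∪ q ∣ ≤_) (∣p∪q∣+∣p∩q∣≡∣p∣+∣q∣ p q) (m≤m+n _ _)

disjoint⇒∣p∪q∣≡∣p∣+∣q∣ : ∀ {n} (p q : Subset n) → (∀ {x} → x ∈ p → x ∉ q) →
                         ∣ p ∪ q ∣ ≡ ∣ p ∣ + ∣ q ∣
disjoint⇒∣p∪q∣≡∣p∣+∣q∣ {n} p q disj =
  trans (sym (+-identityʳ _)) (trans (cong (λ t → ∣ p ∪ q ∣ + t) (sym ∣p∩q∣≡0)) (∣p∪q∣+∣p∩q∣≡∣p∣+∣q∣ p q))
  where
  ∣p∩q∣≡0 : ∣ p ∩ q ∣ ≡ 0
  ∣p∩q∣≡0 = trans (cong ∣_∣ (Empty-unique λ (x , x∈) →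
    let x∈p , x∈q = x∈p∩q⁻ p q x∈ in disj x∈p x∈q)) (∣⊥∣≡0 n)

-- If every element of S is R-related to an element of Q, then so it is
-- already to an element of some part of Q no larger than S.
thin : ∀ {m n} (R : Fin m → Fin n → Set) (S : Subset m) (Q : Subset n) →
       (∀ {v} → v ∈ S → ∃ λ q → q ∈ Q × R v q) →
       ∃ λ Q₀ → Q₀ ⊆ Q × ∣ Q₀ ∣ ≤ ∣ S ∣ × (∀ {v} → v ∈ S → ∃ λ q → q ∈ Q₀ × R v q)
thin {n = n} R [] Q rel = ⊥ , (λ x∈ → contradiction x∈ ∉⊥) , ≤-reflexive (∣⊥∣≡0 n) , λ ()
thin R (outside ∷ S) Q rel with thin (R ∘ suc) S Q (rel ∘ there)
... | Q₀ , Q₀⊆Q , small , rel₀ = Q₀ , Q₀⊆Q , small , λ { (there v∈) → rel₀ v∈ }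
thin R (inside ∷ S) Q rel with thin (R ∘ suc) S Q (rel ∘ there) | rel here
... | Q₀ , Q₀⊆Q , small , rel₀ | q , q∈Q , Rq =
  ⁅ q ⁆ ∪ Q₀ ,
  (λ x∈ → [ (λ x∈q → subst (_∈ Q) (sym (x∈⁅y⁆⇒x≡y q x∈q)) q∈Q) , Q₀⊆Q ]′ (x∈p∪q⁻ ⁅ q ⁆ Q₀ x∈)) ,
  ≤-trans (∣p∪q∣≤∣p∣+∣q∣ ⁅ q ⁆ Q₀)
          (≤-trans (≤-reflexive (cong (λ t → t + ∣ Q₀ ∣) (∣⁅x⁆∣≡1 q))) (s≤s small)) ,
  λ { here → q , p⊆p∪q Q₀ (x∈⁅x⁆ q) , Rq
    ; (there v∈) → let q′ , q′∈ , Rq′ = rel₀ v∈ in q′ , q⊆p∪q ⁅ q ⁆ Q₀ q′∈ , Rq′ }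

-- If k sets cover P, then one of them has at least ∣ P ∣ / k elements.
largeMember : ∀ {n} k (S : Fin (suc k) → Subset n) (P : Subset n) →
              (∀ {v} → v ∈ P → ∃ λ i → v ∈ S i) → ∃ λ i → ∣ P ∣ ≤ suc k * ∣ S i ∣
largeMember zero S P cov = zero , ≤-trans (p⊆q⇒∣p∣≤∣q∣ P⊆S₀) (m≤m+n _ _)
  where
  P⊆S₀ : P ⊆ S zero
  P⊆S₀ v∈ with cov v∈
  ... | zero , v∈S = v∈S
largeMember (suc k) S P cov with largeMember k (S ∘ suc) (P ─ S zero) cov′
  where
  cov′ : ∀ {v} → v ∈ P ─ S zero → ∃ λ i → v ∈ S (suc i)
  cov′ v∈ with cov (p─q⊆p P (S zero) v∈)
  ... | zero  , v∈S = contradiction v∈S (x∈p─q⇒x∉q P (S zero) v∈)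
  ... | suc i , v∈S = i , v∈S
... | i , bound = [ first , later ]′ (≤-total ∣ S (suc i) ∣ ∣ S zero ∣)
  where
  P⊆ : P ⊆ S zero ∪ (P ─ S zero)
  P⊆ {v} v∈ with v ∈? S zero
  ... | yes v∈S = p⊆p∪q _ v∈S
  ... | no  v∉S = q⊆p∪q _ _ (x∈p∧x∉q⇒x∈p─q v∈ v∉S)
  total : ∣ P ∣ ≤ ∣ S zero ∣ + suc k * ∣ S (suc i) ∣
  total = ≤-trans (p⊆q⇒∣p∣≤∣q∣ P⊆) (≤-trans (∣p∪q∣≤∣p∣+∣q∣ (S zero) (P ─ S zero)) (+-monoʳ-≤ ∣ S zero ∣ bound))
  first : ∣ S (suc i) ∣ ≤ ∣ S zero ∣ → ∃ λ i → ∣ P ∣ ≤ suc (suc k) * ∣ S i ∣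
  first le = zero , ≤-trans total (+-monoʳ-≤ ∣ S zero ∣ (*-monoʳ-≤ (suc k) le))
  later : ∣ S zero ∣ ≤ ∣ S (suc i) ∣ → ∃ λ i → ∣ P ∣ ≤ suc (suc k) * ∣ S i ∣
  later le = suc i , ≤-trans total (+-monoˡ-≤ (suc k * ∣ S (suc i) ∣) le)

------------------------------------------------------------------------
-- Arithmetic

-- If x is at most J times y, then it is at most J / (J + 1) of x + y.
splitBound : ∀ J {q n} x y → q ≤ x → x ≤ J * y → x + y ≤ n → suc J * q ≤ J * n
splitBound J {q} {n} x y q≤x x≤Jy x+y≤n = begin
  q + J * q       ≤⟨ +-mono-≤ (≤-trans q≤x x≤Jy) (*-monoʳ-≤ J q≤x) ⟩
  J * y + J * x   ≡⟨ *-distribˡ-+ J y x ⟨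
  J * (y + x)     ≡⟨ cong (J *_) (+-comm y x) ⟩
  J * (x + y)     ≤⟨ *-monoʳ-≤ J x+y≤n ⟩
  J * n           ∎
  where open ≤-Reasoning

-- In the next two bounds, a, b, p, m, s stand for the sizes of the sets
-- Q₀, N, P, M, S in the sink-free case, and r for that of P ─ S.
first∣Q∣-bound : ∀ J .{{_ : NonZero J}} {q a b p m s n} → q ≤ a + p → a ≤ b → p ≤ J * s → s ≤ m →
                 a + (b + p) + m ≤ n → suc J * q ≤ J * n
first∣Q∣-bound J {q} {a} {b} {p} {m} {s} {n} q≤ a≤b p≤Js s≤m sizes =
  splitBound J (a + p) (b + m) q≤
    (begin
      a + p           ≤⟨ +-mono-≤ (≤-trans a≤b (m≤n*m b J)) (≤-trans p≤Js (*-monoʳ-≤ J s≤m)) ⟩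
      J * b + J * m   ≡⟨ *-distribˡ-+ J b m ⟨
      J * (b + m)     ∎)
    (≤-trans (≤-reflexive rearrange) sizes)
  where
  open ≤-Reasoning
  rearrange : a + p + (b + m) ≡ a + (b + p) + m
  rearrange = ℕR.solve (a ∷ᴸ p ∷ᴸ b ∷ᴸ m ∷ᴸ []ᴸ)

second∣Q∣-bound : ∀ J .{{_ : NonZero J}} {q a b p m s r n} → q ≤ m + (a + r) → a ≤ b → p ≤ J * s →
                  r + s ≤ p → m ≤ s → a + (b + p) + m ≤ n → suc J * q ≤ J * n
second∣Q∣-bound J {q} {a} {b} {p} {m} {s} {r} {n} q≤ a≤b p≤Js r+s≤p m≤s sizes =
  splitBound J (m + (a + r)) (b + s) q≤
    (begin
      m + (a + r)     ≡⟨ ℕR.solve (m ∷ᴸ a ∷ᴸ r ∷ᴸ []ᴸ) ⟩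
      a + (r + m)     ≤⟨ +-mono-≤ (≤-trans a≤b (m≤n*m b J))
                           (≤-trans (+-monoʳ-≤ r m≤s) (≤-trans r+s≤p p≤Js)) ⟩
      J * b + J * s   ≡⟨ *-distribˡ-+ J b s ⟨
      J * (b + s)     ∎)
    (begin
      m + (a + r) + (b + s)   ≡⟨ ℕR.solve (m ∷ᴸ a ∷ᴸ r ∷ᴸ b ∷ᴸ s ∷ᴸ []ᴸ) ⟩
      a + (b + (r + s)) + m   ≤⟨ +-monoˡ-≤ m (+-monoʳ-≤ a (+-monoʳ-≤ b r+s≤p)) ⟩
      a + (b + p) + m         ≤⟨ sizes ⟩
      n                       ∎)
  where open ≤-Reasoning

------------------------------------------------------------------------
-- Recurrence in finite sets

-- A sequence in a finite set returns to some earlier value. For a return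
-- after the fewest steps, the values from the earlier visit up to just before
-- the return are distinct.
firstReturn : ∀ {n} (x : ℕ → Fin n) → ∃ λ i → ∃ λ d →
              x (i + suc d) ≡ x i × Injective _≡_ _≡_ (λ (r : Fin (suc d)) → x (i + toℕ r))
firstReturn {n} x = let d , isLeast = least returns? returns in fromLeast d isLeast
  where
  -- The bound by n makes this decidable. A repetition between a visit and
  -- its return is a quicker return, within the same bound.
  Returns : Pred ℕ 0ℓ
  Returns d = ∃ λ (i : Fin (suc n)) → toℕ i + suc d ≤ n × x (toℕ i + suc d) ≡ x (toℕ i)

  returns? : Decidable Returns
  returns? d = any? λ i → (toℕ i + suc d ≤? n) ×-dec (x (toℕ i + suc d) ≟ᶠ x (toℕ i))

  gap : ∀ {a b} → a < b → a + suc (b ∸ suc a) ≡ b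
  gap {a} {b} a<b = trans (+-suc a _) (m+[n∸m]≡n a<b)

  returns : ∃ Returns
  returns with pigeonhole (n<1+n n) (λ (i : Fin (suc n)) → x (toℕ i))
  ... | i , j , i<j , eq =
    toℕ j ∸ suc (toℕ i) , i ,
    subst (_≤ n) (sym (gap i<j)) (≤-pred (toℕ<n j)) ,
    trans (cong x (gap i<j)) (sym eq)

  fromLeast : ∀ d → IsLeast Returns d → ∃ λ i → ∃ λ d →
              x (i + suc d) ≡ x i × Injective _≡_ _≡_ (λ (r : Fin (suc d)) → x (i + toℕ r))
  fromLeast d ((i , i+1+d≤n , returns) , d-least) = toℕ i , d , returns , injective
    where
    noRepeat : ∀ {r r′ : Fin (suc d)} → toℕ r < toℕ r′ → x (toℕ i + toℕ r) ≢ x (toℕ i + toℕ r′)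
    noRepeat {r} {r′} r<r′ eq = <⇒≱ e<d (d-least e
      (fromℕ< i+r<1+n ,
       subst (λ t → t + suc e ≤ n) (sym (toℕ-fromℕ< i+r<1+n)) (subst (_≤ n) (sym shift) i+r′≤n) ,
       subst (λ t → x (t + suc e) ≡ x t) (sym (toℕ-fromℕ< i+r<1+n))
             (trans (cong x shift) (sym eq))))
      where
      e : ℕ
      e = toℕ r′ ∸ suc (toℕ r)
      shift : toℕ i + toℕ r + suc e ≡ toℕ i + toℕ r′
      shift = trans (+-assoc (toℕ i) (toℕ r) (suc e)) (cong (λ t → toℕ i + t) (gap r<r′))
      e<d : e < d
      e<d = ≤-trans (≤-trans (m≤n+m (suc e) (toℕ r)) (≤-reflexive (gap r<r′))) (≤-pred (toℕ<n r′))
      i+r′≤n : toℕ i + toℕ r′ ≤ n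
      i+r′≤n = ≤-trans (+-monoʳ-≤ (toℕ i) (<⇒≤ (toℕ<n r′))) i+1+d≤n
      i+r<1+n : toℕ i + toℕ r < suc n
      i+r<1+n = s≤s (≤-trans (+-monoʳ-≤ (toℕ i) (<⇒≤ r<r′)) i+r′≤n)

    injective : Injective _≡_ _≡_ (λ (r : Fin (suc d)) → x (toℕ i + toℕ r))
    injective {r} {r′} eq with <-cmp (toℕ r) (toℕ r′)
    ... | tri< lt _ _   = contradiction eq (noRepeat lt)
    ... | tri≈ _ r≡r′ _ = toℕ-injective r≡r′
    ... | tri> _ _ gt   = contradiction (sym eq) (noRepeat gt)

module _ {n : ℕ} (D : Digraph n) where

  ----------------------------------------------------------------------
  -- In-neighbourhoods and distance

  outNeighbourIn? : ∀ S → Decidable (λ u → ∃ λ v → v ∈ S × Arc D u v)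
  outNeighbourIn? S u = any? λ v → (v ∈? S) ×-dec arc? D u v

  -- The vertices with an out-neighbour in S; some of them may lie in S.
  N⁻ : Subset n → Subset n
  N⁻ S = select (outNeighbourIn? S)

  -- The vertices at distance at most 1 from S.
  N⁻[_] : Subset n → Subset n
  N⁻[ S ] = S ∪ N⁻ S

  ∈N⁻⁺ : ∀ {S u v} → v ∈ S → Arc D u v → u ∈ N⁻ S
  ∈N⁻⁺ {S} v∈S uv = ∈-select⁺ (outNeighbourIn? S) (_ , v∈S , uv)

  ∈N⁻⁻ : ∀ {S u} → u ∈ N⁻ S → ∃ λ v → v ∈ S × Arc D u v
  ∈N⁻⁻ {S} = ∈-select⁻ (outNeighbourIn? S)

  N⁻-mono : ∀ {S T} → S ⊆ T → N⁻ S ⊆ N⁻ T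
  N⁻-mono S⊆T u∈ = let _ , v∈S , uv = ∈N⁻⁻ u∈ in ∈N⁻⁺ (S⊆T v∈S) uv

  S⊆N⁻[S] : ∀ S → S ⊆ N⁻[ S ]
  S⊆N⁻[S] S = p⊆p∪q (N⁻ S)

  N⁻⊆N⁻[] : ∀ S → N⁻ S ⊆ N⁻[ S ]
  N⁻⊆N⁻[] S = q⊆p∪q S (N⁻ S)

  N⁻[]-mono : ∀ {S T} → S ⊆ T → N⁻[ S ] ⊆ N⁻[ T ]
  N⁻[]-mono {S} {T} S⊆T u∈ =
    [ S⊆N⁻[S] T ∘ S⊆T , N⁻⊆N⁻[] T ∘ N⁻-mono S⊆T ]′ (x∈p∪q⁻ S (N⁻ S) u∈)

  path⇒dist≤ : ∀ {u v ℓ} → PathOfLength D u v ℓ → dist D u v ≤∞ [ ℓ ]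
  path⇒dist≤ {u} {v} path with distance D u v
  ... | _ , finite (_ , min) = finite≤ (min _ path)
  ... | _ , infinite none    = contradiction path (none _)

  distTo≤ : ∀ {u v Q d} → v ∈ Q → dist D u v ≤∞ d → distTo D u Q ≤∞ d
  distTo≤ {Q = Q} v∈Q le = Extrema.min≤v⁺ ≤∞-totalOrder _ _
    (inj₂ (lose (∈-map⁺ (dist D _) (∈-filter⁺ (_∈? Q) (∈-allFin _) v∈Q)) le))

  weaken : ∀ {x d e} → d ≤ e → x ≤∞ [ d ] → x ≤∞ [ e ]
  weaken d≤e x≤d = ≤⁺-trans ≤-trans x≤d (finite≤ d≤e)

  arc⇒≢ : ∀ {u v} → Arc D u v → u ≢ v
  arc⇒≢ uv refl = arc-irrefl D uv

  dist₀ : ∀ u → dist D u u ≤∞ [ 0 ]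
  dist₀ u = path⇒dist≤ ((λ _ → u) , ((λ { {zero} {zero} _ → refl }) , λ ()) , refl , refl)

  dist₁ : ∀ {u v} → Arc D u v → dist D u v ≤∞ [ 1 ]
  dist₁ {u} {v} uv = path⇒dist≤ (p , ((λ {i} {j} → inj i j) , λ { zero → uv }) , refl , refl)
    where
    p : Fin 2 → Fin n
    p zero       = u
    p (suc zero) = v
    inj : ∀ i j → p i ≡ p j → i ≡ j
    inj zero       zero       _  = refl
    inj zero       (suc zero) eq = contradiction eq (arc⇒≢ uv)
    inj (suc zero) zero       eq = contradiction (sym eq) (arc⇒≢ uv)
    inj (suc zero) (suc zero) _  = refl

  dist₂ : ∀ {u w v} → Arc D u w → Arc D w v → dist D u v ≤∞ [ 2 ]
  dist₂ {u} {w} {v} uw wv with u ≟ᶠ v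
  ... | yes refl = weaken z≤n (dist₀ u)
  ... | no  u≢v  =
    path⇒dist≤ (p , ((λ {i} {j} → inj i j) , λ { zero → uw ; (suc zero) → wv }) , refl , refl)
    where
    p : Fin 3 → Fin n
    p zero             = u
    p (suc zero)       = w
    p (suc (suc zero)) = v
    inj : ∀ i j → p i ≡ p j → i ≡ j
    inj zero             zero             _  = refl
    inj zero             (suc zero)       eq = contradiction eq (arc⇒≢ uw)
    inj zero             (suc (suc zero)) eq = contradiction eq u≢v
    inj (suc zero)       zero             eq = contradiction (sym eq) (arc⇒≢ uw)
    inj (suc zero)       (suc zero)       _  = refl
    inj (suc zero)       (suc (suc zero)) eq = contradiction eq (arc⇒≢ wv)
    inj (suc (suc zero)) zero             eq = contradiction (sym eq) u≢v
    inj (suc (suc zero)) (suc zero)       eq = contradiction (sym eq) (arc⇒≢ wv)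
    inj (suc (suc zero)) (suc (suc zero)) _  = refl

  ∈N⁻[]⇒distTo≤1 : ∀ {Q u} → u ∈ N⁻[ Q ] → distTo D u Q ≤∞ [ 1 ]
  ∈N⁻[]⇒distTo≤1 {Q} {u} u∈ with x∈p∪q⁻ Q (N⁻ Q) u∈
  ... | inj₁ u∈Q = distTo≤ u∈Q (weaken z≤n (dist₀ u))
  ... | inj₂ u∈N = let _ , v∈Q , uv = ∈N⁻⁻ u∈N in distTo≤ v∈Q (dist₁ uv)

  ∈N⁻[N⁻[]]⇒distTo≤2 : ∀ {Q u} → u ∈ N⁻[ N⁻[ Q ] ] → distTo D u Q ≤∞ [ 2 ]
  ∈N⁻[N⁻[]]⇒distTo≤2 {Q} {u} u∈ with x∈p∪q⁻ N⁻[ Q ] (N⁻ N⁻[ Q ]) u∈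
  ... | inj₁ u∈N = weaken (s≤s z≤n) (∈N⁻[]⇒distTo≤1 u∈N)
  ... | inj₂ u∈NN with ∈N⁻⁻ u∈NN
  ...   | w , w∈ , uw with x∈p∪q⁻ Q (N⁻ Q) w∈
  ...     | inj₁ w∈Q = distTo≤ w∈Q (weaken (s≤s z≤n) (dist₁ uw))
  ...     | inj₂ w∈N = let _ , v∈Q , wv = ∈N⁻⁻ w∈N in distTo≤ v∈Q (dist₂ uw wv)

  N⁻[]⊆closedN⁻ : ∀ Q → N⁻[ Q ] ⊆ closedN⁻ D Q
  N⁻[]⊆closedN⁻ Q u∈ = ∈-select⁺ (λ u → distTo D u Q ≤∞? [ 1 ]) (∈N⁻[]⇒distTo≤1 u∈)

  nonSink⇒arc : ∀ {v} → ¬ Sink D v → ∃ λ w → Arc D v w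
  nonSink⇒arc {v} ¬sink = decidable-stable (any? (arc? D v))
    (λ none → ¬sink (λ w vw → none (w , vw)))

  ----------------------------------------------------------------------
  -- Kernel-perfect sets

  -- A kernel of the subdigraph induced by B.
  record IsKernel (B K : Subset n) : Set where
    field
      K⊆B         : K ⊆ B
      independent : Independent D K
      absorbing   : B ⊆ N⁻[ K ]

  -- Every subset of A, in particular A itself, has a kernel.
  KernelPerfect : Pred (Subset n) 0ℓ
  KernelPerfect A = ∀ {B} → B ⊆ A → ∃ (IsKernel B)

  -- If B has a sink s, a kernel of the vertices of B outside N⁻[ ⁅ s ⁆ ]
  -- becomes a kernel of B by adding s. So only sets without sinks matter.
  kernelPerfect⁺ : ∀ {A} →
    (∀ {B} → B ⊆ A → Nonempty B → B ⊆ N⁻ B → ∃ (IsKernel B)) → KernelPerfect A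
  kernelPerfect⁺ {A} sinkFree⇒kernel {B} B⊆A = go B B⊆A (⊂-wellFounded B)
    where
    go : ∀ B → B ⊆ A → Acc _⊂_ B → ∃ (IsKernel B)
    go B B⊆A (acc rec) with nonempty? B
    ... | no empty = ⊥ , record
      { K⊆B         = λ x∈ → contradiction x∈ ∉⊥
      ; independent = λ _ _ u∈ → contradiction u∈ ∉⊥
      ; absorbing   = λ x∈ → contradiction (_ , x∈) empty }
    ... | yes nonempty with nonempty? (B ─ N⁻ B)
    ...   | no noSink = sinkFree⇒kernel B⊆A nonempty λ {x} x∈B →
              decidable-stable (x ∈? N⁻ B) λ x∉ → noSink (x , x∈p∧x∉q⇒x∈p─q x∈B x∉)
    ...   | yes (s , s∈) with go (B ─ N⁻[ ⁅ s ⁆ ]) (⊆-trans (p─q⊆p B _) B⊆A)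
                              (rec (p─q⊆p B _ , s , p─q⊆p B (N⁻ B) s∈ ,
                                    λ s∈′ → x∈p─q⇒x∉q B _ s∈′ (S⊆N⁻[S] ⁅ s ⁆ (x∈⁅x⁆ s))))
    ...     | K , isK = ⁅ s ⁆ ∪ K , record
      { K⊆B = λ x∈ → [ (λ x∈s → subst (_∈ B) (sym (x∈⁅y⁆⇒x≡y s x∈s)) s∈B) , K⊆B ]′
                       (x∈p∪q⁻ ⁅ s ⁆ K x∈)
      ; independent = λ u v u∈ v∈ → indep u v (x∈p∪q⁻ ⁅ s ⁆ K u∈) (x∈p∪q⁻ ⁅ s ⁆ K v∈)
      ; absorbing = absorb }
      where
      open IsKernel isK renaming (K⊆B to K⊆B′; independent to independent′; absorbing to absorbing′)
      s∈B : s ∈ B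
      s∈B = p─q⊆p B (N⁻ B) s∈
      K⊆B : K ⊆ B
      K⊆B = p─q⊆p B _ ∘ K⊆B′
      indep : ∀ u v → u ∈ ⁅ s ⁆ ⊎ u ∈ K → v ∈ ⁅ s ⁆ ⊎ v ∈ K → ¬ Arc D u v
      indep u v (inj₂ u∈K) (inj₂ v∈K) uv = independent′ u v u∈K v∈K uv
      indep u v (inj₂ u∈K) (inj₁ v∈s) uv =
        x∈p─q⇒x∉q B _ (K⊆B′ u∈K) (N⁻⊆N⁻[] ⁅ s ⁆ (∈N⁻⁺ v∈s uv))
      indep u v (inj₁ u∈s) v∈ uv =
        x∈p─q⇒x∉q B (N⁻ B) s∈
          (subst (_∈ N⁻ B) (x∈⁅y⁆⇒x≡y s u∈s)
            (∈N⁻⁺ ([ (λ v∈s → subst (_∈ B) (sym (x∈⁅y⁆⇒x≡y s v∈s)) s∈B) , K⊆B ]′ v∈) uv))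
      absorb : B ⊆ N⁻[ ⁅ s ⁆ ∪ K ]
      absorb {x} x∈B with x ∈? N⁻[ ⁅ s ⁆ ]
      ... | yes x∈ = N⁻[]-mono (p⊆p∪q K) x∈
      ... | no  x∉ = N⁻[]-mono (q⊆p∪q ⁅ s ⁆ K) (absorbing′ (x∈p∧x∉q⇒x∈p─q x∈B x∉))

  -- If B had no sink, a walk inside B would go on forever and so trace a
  -- directed cycle.
  acyclic⇒sink : ∀ {S B} → Acyclic D S → B ⊆ S → Nonempty B → ¬ (B ⊆ N⁻ B)
  acyclic⇒sink {S} {B} acyclic B⊆S nonempty sinkFree =
    let i , d , returns , injective = firstReturn x in noReturn i d returns injective
    where
    next : ∃ (_∈ B) → ∃ (_∈ B)
    next (_ , v∈) = let w , w∈ , _ = ∈N⁻⁻ (sinkFree v∈) in w , w∈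

    walk : ℕ → ∃ (_∈ B)
    walk zero    = nonempty
    walk (suc t) = next (walk t)

    x : ℕ → Fin n
    x = proj₁ ∘ walk

    x-arc : ∀ t → Arc D (x t) (x (suc t))
    x-arc t = proj₂ (proj₂ (∈N⁻⁻ (sinkFree (proj₂ (walk t)))))

    noReturn : ∀ i d → x (i + suc d) ≡ x i →
               ¬ Injective _≡_ _≡_ (λ (r : Fin (suc d)) → x (i + toℕ r))
    noReturn i d returns injective =
      acyclic d (c , ((injective , arcs) , close) , λ r → B⊆S (proj₂ (walk (i + toℕ r))))
      where
      c : Fin (suc d) → Fin n
      c r = x (i + toℕ r)
      arcs : ∀ (r : Fin d) → Arc D (c (inject₁ r)) (c (suc r))
      arcs r = subst₂ (Arc D) (cong (λ t → x (i + t)) (sym (toℕ-inject₁ r)))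
                              (cong x (sym (+-suc i (toℕ r))))
                              (x-arc (i + toℕ r))
      close : Arc D (c (fromℕ d)) (c zero)
      close = subst₂ (Arc D)
        (cong (λ t → x (i + t)) (sym (toℕ-fromℕ d)))
        (trans (cong x (sym (+-suc i d))) (trans returns (cong x (sym (+-identityʳ i)))))
        (x-arc (i + d))

  acyclic⇒kernelPerfect : ∀ {S} → Acyclic D S → KernelPerfect S
  acyclic⇒kernelPerfect acyclic = kernelPerfect⁺ λ B⊆S nonempty sinkFree →
    contradiction (λ {x} → sinkFree {x}) (acyclic⇒sink acyclic B⊆S nonempty)

  -- When a bipartite set has no sinks, either side of it is a kernel.
  bipartite⇒kernelPerfect : ∀ {S T U} → Independent D T → Independent D U →
                            S ⊆ T ∪ U → KernelPerfect S
  bipartite⇒kernelPerfect {S} {T} {U} indT indU S⊆T∪U = kernelPerfect⁺ λ {B} B⊆S _ sinkFree →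
    B ∩ T , record
      { K⊆B         = p∩q⊆p B T
      ; independent = λ u v u∈ v∈ → indT u v (p∩q⊆q B T u∈) (p∩q⊆q B T v∈)
      ; absorbing   = λ {x} x∈B → absorb B⊆S sinkFree x∈B (x∈p∪q⁻ T U (S⊆T∪U (B⊆S x∈B))) }
    where
    absorb : ∀ {B} → B ⊆ S → B ⊆ N⁻ B → ∀ {x} → x ∈ B → x ∈ T ⊎ x ∈ U → x ∈ N⁻[ B ∩ T ]
    absorb B⊆S sinkFree x∈B (inj₁ x∈T) = S⊆N⁻[S] _ (x∈p∩q⁺ (x∈B , x∈T))
    absorb B⊆S sinkFree x∈B (inj₂ x∈U) with ∈N⁻⁻ (sinkFree x∈B)
    ... | w , w∈B , xw with x∈p∪q⁻ T U (S⊆T∪U (B⊆S w∈B))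
    ...   | inj₁ w∈T = N⁻⊆N⁻[] _ (∈N⁻⁺ (x∈p∩q⁺ (w∈B , w∈T)) xw)
    ...   | inj₂ w∈U = contradiction xw (indU _ _ x∈U w∈U)

  ----------------------------------------------------------------------
  -- Quasi-kernels absorbing a kernel-perfect set

  -- A quasi-kernel of W, except that the paths from W to Q may leave W.
  record IsQuasiKernelOf (W Q : Subset n) : Set where
    field
      Q⊆W         : Q ⊆ W
      independent : Independent D Q
      absorbing   : W ⊆ N⁻[ N⁻[ Q ] ]

  -- Add to a quasi-kernel of the vertices of W outside N⁻[ B ] a kernel of
  -- what it does not absorb in B; then N⁻ B is reached through B.
  extend : ∀ {W B} → KernelPerfect B → B ⊆ W → ∃ (IsQuasiKernelOf (W ─ N⁻[ B ])) →
           ∃ λ Q → IsQuasiKernelOf W Q × B ⊆ N⁻[ Q ]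
  extend {W} {B} perfect B⊆W (R , isR) with perfect (p─q⊆p B (N⁻ R))
  ... | K , isK = R ∪ K , record
      { Q⊆W = λ x∈ → [ p─q⊆p W _ ∘ R.Q⊆W , B⊆W ∘ K⊆B ]′ (x∈p∪q⁻ R K x∈)
      ; independent = λ u v u∈ v∈ → indep u v (x∈p∪q⁻ R K u∈) (x∈p∪q⁻ R K v∈)
      ; absorbing = absorb }
    , B⊆
    where
    module R = IsQuasiKernelOf isR
    module K = IsKernel isK
    K⊆B : K ⊆ B
    K⊆B = p─q⊆p B (N⁻ R) ∘ K.K⊆B
    indep : ∀ u v → u ∈ R ⊎ u ∈ K → v ∈ R ⊎ v ∈ K → ¬ Arc D u v
    indep u v (inj₁ u∈R) (inj₁ v∈R) uv = R.independent u v u∈R v∈R uv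
    indep u v (inj₁ u∈R) (inj₂ v∈K) uv =
      x∈p─q⇒x∉q W _ (R.Q⊆W u∈R) (N⁻⊆N⁻[] B (∈N⁻⁺ (K⊆B v∈K) uv))
    indep u v (inj₂ u∈K) (inj₁ v∈R) uv = x∈p─q⇒x∉q B (N⁻ R) (K.K⊆B u∈K) (∈N⁻⁺ v∈R uv)
    indep u v (inj₂ u∈K) (inj₂ v∈K) uv = K.independent u v u∈K v∈K uv
    B⊆ : B ⊆ N⁻[ R ∪ K ]
    B⊆ {x} x∈B with x ∈? N⁻ R
    ... | yes x∈ = N⁻[]-mono (p⊆p∪q K) (N⁻⊆N⁻[] R x∈)
    ... | no  x∉ = N⁻[]-mono (q⊆p∪q R K) (K.absorbing (x∈p∧x∉q⇒x∈p─q x∈B x∉))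
    absorb : W ⊆ N⁻[ N⁻[ R ∪ K ] ]
    absorb {x} x∈W with x ∈? N⁻[ B ]
    ... | yes x∈ = N⁻[]-mono B⊆ x∈
    ... | no  x∉ = N⁻[]-mono (N⁻[]-mono (p⊆p∪q K)) (R.absorbing (x∈p∧x∉q⇒x∈p─q x∈W x∉))

  singleton⇒kernelPerfect : ∀ v → KernelPerfect ⁅ v ⁆
  singleton⇒kernelPerfect v {B} B⊆ = B , record
    { K⊆B         = ⊆-refl
    ; independent = λ a b a∈ b∈ ab → arc-irrefl D
        (subst₂ (Arc D) (x∈⁅y⁆⇒x≡y v (B⊆ a∈)) (x∈⁅y⁆⇒x≡y v (B⊆ b∈)) ab)
    ; absorbing   = S⊆N⁻[S] B }

  -- The theorem of Chvátal and Lovász, for the vertices of W.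
  quasiKernelOf : ∀ W → ∃ (IsQuasiKernelOf W)
  quasiKernelOf W = go W (⊂-wellFounded W)
    where
    go : ∀ W → Acc _⊂_ W → ∃ (IsQuasiKernelOf W)
    go W (acc rec) with nonempty? W
    ... | no empty = ⊥ , record
      { Q⊆W         = λ x∈ → contradiction x∈ ∉⊥
      ; independent = λ _ _ u∈ → contradiction u∈ ∉⊥
      ; absorbing   = λ x∈ → contradiction (_ , x∈) empty }
    ... | yes (v , v∈W) =
      let Q , isQ , _ = extend (singleton⇒kernelPerfect v)
            (λ x∈ → subst (_∈ W) (sym (x∈⁅y⁆⇒x≡y v x∈)) v∈W)
            (go (W ─ N⁻[ ⁅ v ⁆ ])
                (rec (p─q⊆p W _ , v , v∈W ,
                      λ v∈′ → x∈p─q⇒x∉q W _ v∈′ (S⊆N⁻[S] ⁅ v ⁆ (x∈⁅x⁆ v)))))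
      in Q , isQ

  quasiKernelAbsorbing : ∀ W {A} → KernelPerfect A →
                         ∃ λ Q → IsQuasiKernelOf W Q × W ∩ A ⊆ N⁻[ Q ]
  quasiKernelAbsorbing W {A} perfect =
    extend (λ B⊆ → perfect (⊆-trans B⊆ (p∩q⊆q W A))) (p∩q⊆p W A) (quasiKernelOf _)

  quasiKernel⁺ : ∀ {Q} → IsQuasiKernelOf ⊤ Q → QuasiKernel D Q
  quasiKernel⁺ isQ = independent , λ u → ∈N⁻[N⁻[]]⇒distTo≤2 (absorbing ∈⊤)
    where open IsQuasiKernelOf isQ

  ----------------------------------------------------------------------
  -- Colourings with kernel-perfect classes

  -- A colouring with at most k colours; classes may be empty.
  KernelPerfectColouring : ℕ → Set
  KernelPerfectColouring k = ∃ λ (c : Fin n → Fin k) → ∀ i → KernelPerfect (class c i)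

  dichromatic⇒colouring : ∀ {k} → dichromaticNumber D ≤ k → KernelPerfectColouring k
  dichromatic⇒colouring {k} m≤k with leastAcyclicPartition D
  ... | m , (f , partition) , _ = c , λ i → acyclic⇒kernelPerfect (acyclicClass i)
    where
    c : Fin n → Fin k
    c v = inject≤ (f v) m≤k
    acyclicClass : ∀ i → Acyclic D (class c i)
    acyclicClass i ℓ (p , cycle , p∈) =
      proj₂ (partition (f (p zero))) ℓ
        (p , cycle , λ r → ≡⇒∈class f (inject≤-injective m≤k m≤k _ _
          (trans (∈class⇒≡ c (p∈ r)) (sym (∈class⇒≡ c (p∈ zero))))))

  -- Pair up 2 * k independent sets: the colour of a vertex is its pair, and
  -- its side tells the two members of a pair apart.
  chromatic⇒colouring : ∀ {k} → chromaticNumber D ≤ 2 * k → KernelPerfectColouring k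
  chromatic⇒colouring {k} m≤2k with leastIndependentPartition D
  ... | m , (f , partition) , _ = c , λ i →
    bipartite⇒kernelPerfect (independentSide zero i) (independentSide (suc zero) i) (twoSides i)
    where
    split : Fin n → Fin 2 × Fin k
    split v = remQuot k (inject≤ (f v) m≤2k)
    c : Fin n → Fin k
    c = proj₂ ∘ split
    side : Fin n → Fin 2
    side = proj₁ ∘ split
    split-injective : ∀ u v → side u ≡ side v → c u ≡ c v → f u ≡ f v
    split-injective u v s≡ c≡ = inject≤-injective m≤2k m≤2k (f u) (f v)
      (trans (sym (combine-remQuot {2} k _)) (trans (cong₂ combine s≡ c≡) (combine-remQuot {2} k _)))
    independentSide : ∀ s i → Independent D (class side s ∩ class c i)
    independentSide s i u v u∈ v∈ =
      let u∈s , u∈i = x∈p∩q⁻ (class side s) (class c i) u∈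
          v∈s , v∈i = x∈p∩q⁻ (class side s) (class c i) v∈
      in proj₂ (partition (f v)) u v
           (≡⇒∈class f (split-injective u v
             (trans (∈class⇒≡ side u∈s) (sym (∈class⇒≡ side v∈s)))
             (trans (∈class⇒≡ c u∈i) (sym (∈class⇒≡ c v∈i)))))
           (≡⇒∈class f refl)
    twoSides : ∀ i → class c i ⊆ (class side zero ∩ class c i) ∪ (class side (suc zero) ∩ class c i)
    twoSides i {x} x∈ with side x in eq
    ... | zero     = p⊆p∪q _ (x∈p∩q⁺ (≡⇒∈class side eq , x∈))
    ... | suc zero = q⊆p∪q _ _ (x∈p∩q⁺ (≡⇒∈class side eq , x∈))

  ----------------------------------------------------------------------
  -- A quasi-kernel with a large closed in-neighbourhood

  largeQuasiKernel : ∀ {k} → KernelPerfectColouring (suc k) →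
    ∃ λ Q → QuasiKernel D Q × n ≤ suc k * ∣ closedN⁻ D Q ∣
  largeQuasiKernel {k} (c , perfect)
    = let i , bound = largeMember k (class c) ⊤ (λ {v} _ → c v , ≡⇒∈class c refl)
          Q , isQ , absorbs = quasiKernelAbsorbing ⊤ (perfect i)
      in Q , quasiKernel⁺ isQ , (begin
    n                          ≡⟨ ∣⊤∣≡n n ⟨
    ∣ ⊤ {n} ∣                  ≤⟨ bound ⟩
    suc k * ∣ class c i ∣      ≤⟨ *-monoʳ-≤ (suc k) (p⊆q⇒∣p∣≤∣q∣ λ v∈ →
                                    N⁻[]⊆closedN⁻ Q (absorbs (x∈p∩q⁺ (∈⊤ , v∈)))) ⟩
    suc k * ∣ closedN⁻ D Q ∣   ∎)
    where open ≤-Reasoning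

  ----------------------------------------------------------------------
  -- A quasi-kernel avoiding many sources

  quasiKernelAvoidingSources : ∀ {k} → KernelPerfectColouring (suc k) →
    ∃ λ Q → QuasiKernel D Q × suc k * ∣ Q ∣ + ∣ nonSinkSources D ∣ ≤ suc k * n
  quasiKernelAvoidingSources {k} (c , perfect) =
    let i , bound = largeMember k T S cover
        R , isR , absorbs = quasiKernelAbsorbing W (perfect i)
    in fromClass i bound R isR absorbs
    where
    S W : Subset n
    S = nonSinkSources D
    W = ∁ S

    isNonSinkSource : ∀ {s} → s ∈ S → Source D s × ¬ Sink D s
    isNonSinkSource = ∈-select⁻ (λ v → source? D v ×-dec ¬? (sink? D v))

    source : ∀ {u s} → s ∈ S → ¬ Arc D u s
    source s∈ = proj₁ (isNonSinkSource s∈) _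

    -- The sources avoided when class i is absorbed.
    T : Fin (suc k) → Subset n
    T i = S ∩ N⁻ (W ∩ class c i)

    cover : ∀ {s} → s ∈ S → ∃ λ i → s ∈ T i
    cover s∈ = let w , sw = nonSink⇒arc (proj₂ (isNonSinkSource s∈)) in
      c w , x∈p∩q⁺ (s∈ , ∈N⁻⁺ (x∈p∩q⁺ (x∉p⇒x∈∁p (λ w∈ → source w∈ sw) , ≡⇒∈class c refl)) sw)

    fromClass : ∀ i → ∣ S ∣ ≤ suc k * ∣ T i ∣ → ∀ R → IsQuasiKernelOf W R → W ∩ class c i ⊆ N⁻[ R ] →
                ∃ λ Q → QuasiKernel D Q × suc k * ∣ Q ∣ + ∣ S ∣ ≤ suc k * n
    fromClass i bound R isR absorbs = R ∪ F , quasiKernel⁺ isQ , (begin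
      suc k * ∣ R ∪ F ∣ + ∣ S ∣             ≤⟨ +-monoʳ-≤ (suc k * ∣ R ∪ F ∣) bound ⟩
      suc k * ∣ R ∪ F ∣ + suc k * ∣ T i ∣   ≡⟨ *-distribˡ-+ (suc k) ∣ R ∪ F ∣ ∣ T i ∣ ⟨
      suc k * (∣ R ∪ F ∣ + ∣ T i ∣)         ≡⟨ cong (suc k *_) (disjoint⇒∣p∪q∣≡∣p∣+∣q∣ (R ∪ F) (T i) avoids) ⟨
      suc k * ∣ (R ∪ F) ∪ T i ∣             ≤⟨ *-monoʳ-≤ (suc k) (∣p∣≤n ((R ∪ F) ∪ T i)) ⟩
      suc k * n                             ∎)
      where
      open ≤-Reasoning
      module R = IsQuasiKernelOf isR
      -- The sources at distance more than 2 from R.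
      F : Subset n
      F = S ─ N⁻[ N⁻[ R ] ]
      F⊆S : F ⊆ S
      F⊆S = p─q⊆p S _
      avoids : ∀ {x} → x ∈ R ∪ F → x ∉ T i
      avoids x∈ x∈T with x∈p∩q⁻ S _ x∈T | x∈p∪q⁻ R F x∈
      ... | x∈S , _  | inj₁ x∈R = x∈∁p⇒x∉p (R.Q⊆W x∈R) x∈S
      ... | _   , x∈N | inj₂ x∈F =
        x∈p─q⇒x∉q S _ x∈F (N⁻⊆N⁻[] N⁻[ R ] (N⁻-mono absorbs x∈N))
      indep : ∀ u v → u ∈ R ⊎ u ∈ F → v ∈ R ⊎ v ∈ F → ¬ Arc D u v
      indep u v _          (inj₂ v∈F) uv = source (F⊆S v∈F) uv
      indep u v (inj₁ u∈R) (inj₁ v∈R) uv = R.independent u v u∈R v∈R uv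
      indep u v (inj₂ u∈F) (inj₁ v∈R) uv =
        x∈p─q⇒x∉q S _ u∈F (S⊆N⁻[S] N⁻[ R ] (N⁻⊆N⁻[] R (∈N⁻⁺ v∈R uv)))
      absorb : ⊤ ⊆ N⁻[ N⁻[ R ∪ F ] ]
      absorb {x} _ = [ N⁻[]-mono (N⁻[]-mono (p⊆p∪q F)) , far ]′ (toSum (x ∈? N⁻[ N⁻[ R ] ]))
        where
        far : x ∉ N⁻[ N⁻[ R ] ] → x ∈ N⁻[ N⁻[ R ∪ F ] ]
        far x∉ = S⊆N⁻[S] _ (S⊆N⁻[S] _ (q⊆p∪q R F (x∈p∧x∉q⇒x∈p─q x∈S x∉)))
          where
          x∈S : x ∈ S
          x∈S = decidable-stable (x ∈? S) (x∉ ∘ R.absorbing ∘ x∉p⇒x∈∁p)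
      isQ : IsQuasiKernelOf ⊤ (R ∪ F)
      isQ = record
        { Q⊆W         = ⊆⊤
        ; independent = λ u v u∈ v∈ → indep u v (x∈p∪q⁻ R F u∈) (x∈p∪q⁻ R F v∈)
        ; absorbing   = absorb }

  ----------------------------------------------------------------------
  -- Small quasi-kernels of digraphs without sinks

  -- Q is a quasi-kernel with class 0 within distance 1, and Q₀ a part of it no
  -- larger than N⁻ Q that has the same in-neighbours.
  module _ {j} (c : Fin n → Fin (suc (suc j))) (noSinks : SinkFree D)
           {Q Q₀} (isQ : IsQuasiKernelOf ⊤ Q) (class₀⊆N⁻[Q] : class c zero ⊆ N⁻[ Q ])
           (Q₀⊆Q : Q₀ ⊆ Q) (∣Q₀∣≤∣N∣ : ∣ Q₀ ∣ ≤ ∣ N⁻ Q ∣) (N⊆N⁻Q₀ : N⁻ Q ⊆ N⁻ Q₀) where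
    private
      module Q = IsQuasiKernelOf isQ

    N P M : Subset n
    N = N⁻ Q
    P = (Q ─ Q₀) ─ N⁻ N
    -- M includes the vertices of Q ─ Q₀ that are left out of P.
    M = ∁ (Q₀ ∪ (N ∪ P))

    N∩Q≡∅ : ∀ {x} → x ∈ N → x ∉ Q
    N∩Q≡∅ x∈N x∈Q = let _ , w∈Q , xw = ∈N⁻⁻ x∈N in Q.independent _ _ x∈Q w∈Q xw

    P⊆Q : P ⊆ Q
    P⊆Q = p─q⊆p Q Q₀ ∘ p─q⊆p (Q ─ Q₀) (N⁻ N)

    Q₀∪P⊆Q : Q₀ ∪ P ⊆ Q
    Q₀∪P⊆Q x∈ = [ Q₀⊆Q , P⊆Q ]′ (x∈p∪q⁻ Q₀ P x∈)

    Q₀∩[N∪P]≡∅ : ∀ {x} → x ∈ Q₀ → x ∉ N ∪ P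
    Q₀∩[N∪P]≡∅ x∈Q₀ x∈ with x∈p∪q⁻ N P x∈
    ... | inj₁ x∈N = N∩Q≡∅ x∈N (Q₀⊆Q x∈Q₀)
    ... | inj₂ x∈P = x∈p─q⇒x∉q Q Q₀ (p─q⊆p (Q ─ Q₀) (N⁻ N) x∈P) x∈Q₀

    sizes : ∣ Q₀ ∣ + (∣ N ∣ + ∣ P ∣) + ∣ M ∣ ≤ n
    sizes = begin
      ∣ Q₀ ∣ + (∣ N ∣ + ∣ P ∣) + ∣ M ∣
        ≡⟨ cong (λ t → ∣ Q₀ ∣ + t + ∣ M ∣) (disjoint⇒∣p∪q∣≡∣p∣+∣q∣ N P λ x∈N → N∩Q≡∅ x∈N ∘ P⊆Q) ⟨
      ∣ Q₀ ∣ + ∣ N ∪ P ∣ + ∣ M ∣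
        ≡⟨ cong (λ t → t + ∣ M ∣) (disjoint⇒∣p∪q∣≡∣p∣+∣q∣ Q₀ (N ∪ P) Q₀∩[N∪P]≡∅) ⟨
      ∣ Q₀ ∪ (N ∪ P) ∣ + ∣ M ∣
        ≡⟨ disjoint⇒∣p∪q∣≡∣p∣+∣q∣ (Q₀ ∪ (N ∪ P)) M (λ x∈ x∈M → x∈∁p⇒x∉p x∈M x∈) ⟨
      ∣ (Q₀ ∪ (N ∪ P)) ∪ M ∣
        ≤⟨ ∣p∣≤n ((Q₀ ∪ (N ∪ P)) ∪ M) ⟩
      n ∎
      where open ≤-Reasoning

    -- The vertices of P that can be dropped when class suc i is absorbed in M.
    S : Fin (suc j) → Subset n
    S i = P ∩ N⁻ (M ∩ class c (suc i))

    cover : ∀ {p} → p ∈ P → ∃ λ i → p ∈ S i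
    cover {p} p∈P with nonSink⇒arc (noSinks p)
    ... | w , pw = colour (c w) refl
      where
      w∉N : w ∉ N
      w∉N w∈N = x∈p─q⇒x∉q (Q ─ Q₀) (N⁻ N) p∈P (∈N⁻⁺ w∈N pw)
      w∉Q : w ∉ Q
      w∉Q w∈Q = Q.independent _ _ (P⊆Q p∈P) w∈Q pw
      w∈M : w ∈ M
      w∈M = x∉p⇒x∈∁p λ w∈ →
        [ w∉Q ∘ Q₀⊆Q , [ w∉N , w∉Q ∘ P⊆Q ]′ ∘ x∈p∪q⁻ N P ]′ (x∈p∪q⁻ Q₀ (N ∪ P) w∈)
      colour : ∀ i → c w ≡ i → ∃ λ i → p ∈ S i
      colour zero    eq = contradiction (class₀⊆N⁻[Q] (≡⇒∈class c eq))
                                        ([ w∉Q , w∉N ]′ ∘ x∈p∪q⁻ Q N)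
      colour (suc i) eq = i , x∈p∩q⁺ (p∈P , ∈N⁻⁺ (x∈p∩q⁺ (w∈M , ≡⇒∈class c eq)) pw)

    -- Neither N nor a vertex with an out-neighbour in N needs Q ─ Q₀.
    isQuasiKernel₁ : IsQuasiKernelOf ⊤ (Q₀ ∪ P)
    isQuasiKernel₁ = record
      { Q⊆W         = ⊆⊤
      ; independent = λ u v u∈ v∈ → Q.independent u v (Q₀∪P⊆Q u∈) (Q₀∪P⊆Q v∈)
      ; absorbing   = λ _ → absorb (Q.absorbing ∈⊤) }
      where
      N⊆ : N ⊆ N⁻[ Q₀ ∪ P ]
      N⊆ = N⁻[]-mono (p⊆p∪q P) ∘ N⁻⊆N⁻[] Q₀ ∘ N⊆N⁻Q₀
      Q⊆ : Q ⊆ N⁻[ N⁻[ Q₀ ∪ P ] ]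
      Q⊆ {x} x∈Q with x ∈? Q₀ | x ∈? N⁻ N
      ... | yes x∈Q₀ | _       = S⊆N⁻[S] _ (S⊆N⁻[S] _ (p⊆p∪q P x∈Q₀))
      ... | no _     | yes x∈N = N⁻⊆N⁻[] _ (N⁻-mono N⊆ x∈N)
      ... | no x∉Q₀  | no  x∉N =
        S⊆N⁻[S] _ (S⊆N⁻[S] _ (q⊆p∪q Q₀ P (x∈p∧x∉q⇒x∈p─q (x∈p∧x∉q⇒x∈p─q x∈Q x∉Q₀) x∉N)))
      absorb : ∀ {x} → x ∈ N⁻[ N⁻[ Q ] ] → x ∈ N⁻[ N⁻[ Q₀ ∪ P ] ]
      absorb x∈ with x∈p∪q⁻ N⁻[ Q ] _ x∈
      ... | inj₁ x∈NQ = [ Q⊆ , S⊆N⁻[S] _ ∘ N⊆ ]′ (x∈p∪q⁻ Q N x∈NQ)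
      ... | inj₂ x∈NN with ∈N⁻⁻ x∈NN
      ...   | w , w∈ , xw =
        [ (λ w∈Q → S⊆N⁻[S] _ (N⊆ (∈N⁻⁺ w∈Q xw)))
        , (λ w∈N → N⁻⊆N⁻[] _ (∈N⁻⁺ (N⊆ w∈N) xw)) ]′ (x∈p∪q⁻ Q N w∈)

    module _ {i} {R} (isR : IsQuasiKernelOf M R) (absorbs : M ∩ class c (suc i) ⊆ N⁻[ R ]) where
      private
        module R = IsQuasiKernelOf isR
        F : Subset n
        F = Q₀ ∪ (P ─ S i)

      -- R replaces S i, which it absorbs, and the vertices of Q₀ and P with an
      -- arc to R. Vertices of N have an arc to Q₀, hence to Q₂ or to a vertex
      -- with an arc to R.
      Q₂ : Subset n
      Q₂ = R ∪ (F ─ N⁻ R)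

      private
        F⊆Q : F ⊆ Q
        F⊆Q x∈ = [ Q₀⊆Q , P⊆Q ∘ p─q⊆p P (S i) ]′ (x∈p∪q⁻ Q₀ (P ─ S i) x∈)

        R⊆Q₂ : R ⊆ Q₂
        R⊆Q₂ = p⊆p∪q (F ─ N⁻ R)

        F⊆ : F ⊆ N⁻[ Q₂ ]
        F⊆ {x} x∈F with x ∈? N⁻ R
        ... | yes x∈ = N⁻[]-mono R⊆Q₂ (N⁻⊆N⁻[] R x∈)
        ... | no  x∉ = S⊆N⁻[S] Q₂ (q⊆p∪q R (F ─ N⁻ R) (x∈p∧x∉q⇒x∈p─q x∈F x∉))

        indep : ∀ u v → u ∈ R ⊎ u ∈ F ─ N⁻ R → v ∈ R ⊎ v ∈ F ─ N⁻ R → ¬ Arc D u v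
        indep u v (inj₁ u∈R) (inj₁ v∈R) uv = R.independent u v u∈R v∈R uv
        indep u v (inj₁ u∈R) (inj₂ v∈F) uv =
          x∈∁p⇒x∉p (R.Q⊆W u∈R) (q⊆p∪q Q₀ (N ∪ P) (p⊆p∪q P (∈N⁻⁺ (F⊆Q (p─q⊆p F (N⁻ R) v∈F)) uv)))
        indep u v (inj₂ u∈F) (inj₁ v∈R) uv = x∈p─q⇒x∉q F (N⁻ R) u∈F (∈N⁻⁺ v∈R uv)
        indep u v (inj₂ u∈F) (inj₂ v∈F) uv =
          Q.independent u v (F⊆Q (p─q⊆p F (N⁻ R) u∈F)) (F⊆Q (p─q⊆p F (N⁻ R) v∈F)) uv

        M⊆ : M ⊆ N⁻[ N⁻[ Q₂ ] ]
        M⊆ = N⁻[]-mono (N⁻[]-mono R⊆Q₂) ∘ R.absorbing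

        Q₀⊆ : Q₀ ⊆ N⁻[ N⁻[ Q₂ ] ]
        Q₀⊆ = S⊆N⁻[S] N⁻[ Q₂ ] ∘ F⊆ ∘ p⊆p∪q (P ─ S i)

        N⊆ : N ⊆ N⁻[ N⁻[ Q₂ ] ]
        N⊆ = N⁻⊆N⁻[] N⁻[ Q₂ ] ∘ N⁻-mono (F⊆ ∘ p⊆p∪q (P ─ S i)) ∘ N⊆N⁻Q₀

        P⊆ : P ⊆ N⁻[ N⁻[ Q₂ ] ]
        P⊆ {x} x∈P = [ dropped , kept ]′ (toSum (x ∈? S i))
          where
          dropped : x ∈ S i → x ∈ N⁻[ N⁻[ Q₂ ] ]
          dropped x∈S = N⁻⊆N⁻[] N⁻[ Q₂ ] (N⁻-mono (N⁻[]-mono R⊆Q₂ ∘ absorbs) (p∩q⊆q P _ x∈S))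
          kept : x ∉ S i → x ∈ N⁻[ N⁻[ Q₂ ] ]
          kept x∉S = S⊆N⁻[S] N⁻[ Q₂ ] (F⊆ (q⊆p∪q Q₀ (P ─ S i) (x∈p∧x∉q⇒x∈p─q x∈P x∉S)))

        absorb : ⊤ ⊆ N⁻[ N⁻[ Q₂ ] ]
        absorb {x} _ =
          [ M⊆ , [ Q₀⊆ , [ N⊆ , P⊆ ]′ ∘ x∈p∪q⁻ N P ]′ ∘ x∈p∪q⁻ Q₀ (N ∪ P) ∘ x∉∁p⇒x∈p ]′
          (toSum (x ∈? M))

      isQuasiKernel₂ : IsQuasiKernelOf ⊤ Q₂
      isQuasiKernel₂ = record
        { Q⊆W         = ⊆⊤
        ; independent = λ u v u∈ v∈ → indep u v (x∈p∪q⁻ R (F ─ N⁻ R) u∈) (x∈p∪q⁻ R (F ─ N⁻ R) v∈)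
        ; absorbing   = absorb }

      ∣Q₂∣≤ : ∣ Q₂ ∣ ≤ ∣ M ∣ + (∣ Q₀ ∣ + ∣ P ─ S i ∣)
      ∣Q₂∣≤ = ≤-trans (∣p∪q∣≤∣p∣+∣q∣ R (F ─ N⁻ R))
        (+-mono-≤ (p⊆q⇒∣p∣≤∣q∣ R.Q⊆W)
                  (≤-trans (p⊆q⇒∣p∣≤∣q∣ (p─q⊆p F (N⁻ R))) (∣p∪q∣≤∣p∣+∣q∣ Q₀ (P ─ S i))))

    ∣P─Si∣+∣Si∣≤∣P∣ : ∀ i → ∣ P ─ S i ∣ + ∣ S i ∣ ≤ ∣ P ∣
    ∣P─Si∣+∣Si∣≤∣P∣ i = ≤-trans
      (≤-reflexive (sym (disjoint⇒∣p∪q∣≡∣p∣+∣q∣ (P ─ S i) (S i) (x∈p─q⇒x∉q P (S i)))))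
      (p⊆q⇒∣p∣≤∣q∣ λ x∈ → [ p─q⊆p P (S i) , p∩q⊆p P _ ]′ (x∈p∪q⁻ (P ─ S i) (S i) x∈))

    improve : (∀ i → KernelPerfect (class c i)) →
              ∃ λ Q → QuasiKernel D Q × suc (suc j) * ∣ Q ∣ ≤ suc j * n
    improve perfect =
      let i , bound = largeMember j S P cover in [ second i bound , first i bound ]′ (≤-total ∣ M ∣ ∣ S i ∣)
      where
      first : ∀ i → ∣ P ∣ ≤ suc j * ∣ S i ∣ → ∣ S i ∣ ≤ ∣ M ∣ →
              ∃ λ Q → QuasiKernel D Q × suc (suc j) * ∣ Q ∣ ≤ suc j * n
      first i bound s≤m =
        Q₀ ∪ P , quasiKernel⁺ isQuasiKernel₁ ,
        first∣Q∣-bound (suc j) (∣p∪q∣≤∣p∣+∣q∣ Q₀ P) ∣Q₀∣≤∣N∣ bound s≤m sizes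
      second : ∀ i → ∣ P ∣ ≤ suc j * ∣ S i ∣ → ∣ M ∣ ≤ ∣ S i ∣ →
               ∃ λ Q → QuasiKernel D Q × suc (suc j) * ∣ Q ∣ ≤ suc j * n
      second i bound m≤s =
        let R , isR , absorbs = quasiKernelAbsorbing M (perfect (suc i)) in
        Q₂ isR absorbs , quasiKernel⁺ (isQuasiKernel₂ isR absorbs) ,
        second∣Q∣-bound (suc j) (∣Q₂∣≤ isR absorbs) ∣Q₀∣≤∣N∣ bound
                        (∣P─Si∣+∣Si∣≤∣P∣ i) m≤s sizes

  smallQuasiKernel : ∀ {j} → KernelPerfectColouring (suc (suc j)) → SinkFree D →
    ∃ λ Q → QuasiKernel D Q × suc (suc j) * ∣ Q ∣ ≤ suc j * n
  smallQuasiKernel (c , perfect) noSinks =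
    let Q , isQ , absorbs = quasiKernelAbsorbing ⊤ (perfect zero)
        Q₀ , Q₀⊆Q , small , N⇒ = thin (Arc D) (N⁻ Q) Q ∈N⁻⁻
    in improve c noSinks isQ (λ v∈ → absorbs (x∈p∩q⁺ (∈⊤ , v∈))) Q₀⊆Q small
         (λ v∈ → let _ , q∈ , vq = N⇒ v∈ in ∈N⁻⁺ q∈ vq) perfect

------------------------------------------------------------------------
-- Inequalities between fractions

-- The right-hand sides of difference and product are the numerators of the
-- bounds below, as the operations on fractions compute them.
private
  cancel : ∀ x y → x ℤ.+ y ℤ.- y ≡ x
  cancel = ℤR.solve-∀

  difference : ∀ k n s → k ℤ.* n ℤ.- s ≡ (n ℤ.* k ℤ.+ (ℤ.- s) ℤ.* 1ℤ) ℤ.* 1ℤ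
  difference = ℤR.solve-∀

  product : ∀ k n → k ℤ.* n ℤ.- n ≡ ((1ℤ ℤ.* k ℤ.+ (ℤ.- 1ℤ) ℤ.* 1ℤ) ℤ.* n) ℤ.* 1ℤ
  product = ℤR.solve-∀

m+n≤o⇒m≤o-n : ∀ {m o} n → m + n ≤ o → + m ℤ.≤ + o ℤ.- + n
m+n≤o⇒m≤o-n {m} {o} n le = subst (ℤ._≤ + o ℤ.- + n)
  (trans (cong (ℤ._- + n) (ℤP.pos-+ m n)) (cancel (+ m) (+ n)))
  (ℤP.+-monoˡ-≤ (ℤ.- (+ n)) (ℤ.+≤+ le))

≤n-s/k : ∀ k {q s n} → suc k * q + s ≤ suc k * n →
         (+ q) / 1 ℚ.≤ (+ n) / 1 ℚ.- (+ s) / suc k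
≤n-s/k k {q} {s} {n} bound = ℚ.*≤* (subst₂ ℤ._≤_ lhs rhs (m+n≤o⇒m≤o-n s bound))
  where
  lhs : + (suc k * q) ≡ + q ℤ.* + (1 * suc k)
  lhs = trans (cong +_ (trans (*-comm (suc k) q) (cong (q *_) (sym (*-identityˡ (suc k))))))
              (ℤP.pos-* q (1 * suc k))
  rhs : + (suc k * n) ℤ.- + s ≡ ((+ n) ℤ.* + suc k ℤ.+ (ℤ.- + s) ℤ.* 1ℤ) ℤ.* 1ℤ
  rhs = trans (cong (ℤ._- + s) (ℤP.pos-* (suc k) n)) (difference (+ suc k) (+ n) (+ s))

≤[1-1/k]n : ∀ k {q n} → suc k * q ≤ k * n →
            (+ q) / 1 ℚ.≤ (1ℚᵘ ℚ.- (+ 1) / suc k) ℚ.* ((+ n) / 1)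
≤[1-1/k]n k {q} {n} bound = ℚ.*≤* (subst₂ ℤ._≤_ lhs rhs (m+n≤o⇒m≤o-n n bound′))
  where
  bound′ : suc k * q + n ≤ suc k * n
  bound′ = ≤-trans (+-monoˡ-≤ n bound) (≤-reflexive (+-comm (k * n) n))
  lhs : + (suc k * q) ≡ + q ℤ.* + (1 * suc k * 1)
  lhs = trans (cong +_ (trans (*-comm (suc k) q)
                (cong (q *_) (sym (trans (*-identityʳ (1 * suc k)) (*-identityˡ (suc k)))))))
              (ℤP.pos-* q (1 * suc k * 1))
  rhs : + (suc k * n) ℤ.- + n ≡ ((1ℤ ℤ.* + suc k ℤ.+ (ℤ.- 1ℤ) ℤ.* 1ℤ) ℤ.* + n) ℤ.* 1ℤ
  rhs = trans (cong (ℤ._- + n) (ℤP.pos-* (suc k) n)) (product (+ suc k) (+ n))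

n/k≤ : ∀ k {m n} → n ≤ suc k * m → (+ n) / suc k ℚ.≤ (+ m) / 1
n/k≤ k {m} {n} bound = ℚ.*≤* (subst₂ ℤ._≤_ lhs (ℤP.pos-* m (suc k)) (ℤ.+≤+ bound′))
  where
  lhs : + n ≡ + n ℤ.* 1ℤ
  lhs = sym (ℤP.*-identityʳ (+ n))
  bound′ : n ≤ m * suc k
  bound′ = ≤-trans bound (≤-reflexive (*-comm (suc k) m))

corollary1p10 : ∀ (k : ℕ) (2≤k : 2 ≤ k) {n : ℕ} (D : Digraph n) →
    dichromaticNumber D ≤ k ⊎ chromaticNumber D ≤ 2 * k →
    let instance k≢0 = ≥2⇒nonZero 2≤k in
    (SinkFree D →
    ∃[ Q ] QuasiKernel D Q ×
    (+ ∣ Q ∣) / 1 ℚ.≤ (1ℚᵘ ℚ.- (+ 1) / k) ℚ.* ((+ n) / 1))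
    × (∃[ Q ] QuasiKernel D Q ×
    (+ ∣ Q ∣) / 1 ℚ.≤ (+ n) / 1 ℚ.- (+ ∣ nonSinkSources D ∣) / k)
    × (∃[ Q ] QuasiKernel D Q ×
    (+ ∣ closedN⁻ D Q ∣) / 1 ℚ.≥ (+ n) / k)
corollary1p10 (suc (suc j)) (s≤s (s≤s z≤n)) {n} D few =
  (λ noSinks → let Q , isQ , bound = smallQuasiKernel D colouring noSinks in
     Q , isQ , ≤[1-1/k]n (suc j) bound) ,
  (let Q , isQ , bound = quasiKernelAvoidingSources D colouring in
     Q , isQ , ≤n-s/k (suc j) {∣ Q ∣} {∣ nonSinkSources D ∣} {n} bound) ,
  (let Q , isQ , bound = largeQuasiKernel D colouring in Q , isQ , n/k≤ (suc j) bound)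
  where
  colouring : KernelPerfectColouring D (suc (suc j))
  colouring = [ dichromatic⇒colouring D , chromatic⇒colouring D ]′ few
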